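{- Let $G$ be a board with an involution $\tau$ such that every bounded cell is either self-involutive or nowhere-involutive. If there is no self-involutive edge, then Player~2 has a winning strategy in the Game of Cycles on $G$. If there is exactly one self-involutive edge, and its endpoints are not fixed by $\tau$, then Player~1 has a winning strategy.
   Context: The Game of Cycles. A board is a simple connected planar graph embedded in the plane, together with its bounded cells. Two players alternate turns; on a turn a player marks one unmarked edge with an arrow pointing along the edge in one of its two directions. Each edge receives at most one arrow, and arrows have the same effect regardless of who placed them. Moves must obey the sink-source rule: no move may create a sink (a vertex all of whose incident edges are marked with arrows pointing toward it) or a source (a vertex all of whose incident edges are marked with arrows pointing away from it). A player who has a legal move must make one. A cycle cell is a bounded cell all of whose boundary edges are marked with arrows all cycling in the same direction around that cell. The first player to create a cycle cell wins; if play ends (no legal move remains) without a cycle cell, the player who made the last move wins. A winning strategy guarantees a win regardless of the opponent's moves. Involutions: a symmetry of a board is a bijection of its vertices, edges and bounded cells preserving the board structure (incidences and cells); an involution is a non-trivial symmetry $\tau$ with $\tau\circ\tau=\mathrm{id}$. The partner of a vertex, edge or cell $x$ is $\tau(x)$. A vertex, edge or cell is self-involutive if it equals its partner (a self-involutive edge need not have its endpoints fixed, and a self-involutive cell need not fix its edges or vertices). A cell is part-involutive if it is not self-involutive but some edge of the cell has its partner also in the cell; a cell is nowhere-involutive if no edge of the cell has its partner in the cell.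
   Formalization: In the second claim the board with a single edge is excluded: there, with the swap of its two endpoints, either arrow creates a sink and a source, so Player 1 has no legal move. A Player 1 without a first move is taken to lose. -}

module Defs where

open import Data.Bool.Base using (Bool; not)
open import Data.Fin.Base using (Fin)
open import Data.Fin.Permutation using (Permutation′; _⟨$⟩ʳ_)
open import Data.Maybe.Base using (Maybe; just; nothing)
open import Data.Nat.Base using (ℕ; _+_)
open import Data.Product.Base using (∃; ∃-syntax; _×_; _,_; proj₁)
open import Data.Sum.Base using (_⊎_)
open import Data.Vec.Base using (Vec; lookup; replicate; _[_]≔_)
open import Function.Bundles using (_↔_; _⇔_; Inverse)
open import Relation.Binary.Construct.Closure.ReflexiveTransitive using (Star)
open import Relation.Binary.PropositionalEquality.Core using (_≡_; _≢_)
open import Relation.Nullary.Negation.Core using (¬_)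

-- A dart is an edge together with one of its two directions; it stands both
-- for a side of the edge and for an arrow drawn on it.
DartOf : ℕ → Set
DartOf nE = Fin nE × Bool

edge : ∀ {nE} → DartOf nE → Fin nE
edge = proj₁

rev : ∀ {nE} → DartOf nE → DartOf nE
rev (e , b) = e , not b

-- The orbit of x under f (as a set, when f is a permutation of a finite type).
Orbit : {A : Set} → (A → A) → A → A → Set
Orbit f = Star (λ x y → f x ≡ y)

-- A finite simple connected graph embedded in the plane, given by its
-- combinatorial map: a rotation system of genus 0 with a distinguished
-- unbounded face.
record Board : Set where
  field
    nV nE nC : ℕ   -- numbers of vertices, edges and bounded cells

  Vertex : Set
  Vertex = Fin nV

  Edge : Set
  Edge = Fin nE

  Cell : Set
  Cell = Fin nC

  Dart : Set
  Dart = DartOf nE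

  field
    src : Dart → Vertex

  tgt : Dart → Vertex
  tgt d = src (rev d)

  Adjacent : Vertex → Vertex → Set
  Adjacent u v = ∃[ d ] (src d ≡ u × tgt d ≡ v)

  field
    no-loops     : ∀ d → src d ≢ tgt d
    no-multi     : ∀ d d′ → src d ≡ src d′ → tgt d ≡ tgt d′ → d ≡ d′
    connected    : ∀ u v → Star Adjacent u v

    -- The cyclic order, in the plane, of the darts leaving each vertex.
    rotation     : Dart ↔ Dart

  rot : Dart → Dart
  rot = Inverse.to rotation

  -- The dart following d on the boundary walk of the face on a fixed side of d.
  φ : Dart → Dart
  φ d = rot (rev d)

  field
    rot-src      : ∀ d → src (rot d) ≡ src d
    rot-orbit    : ∀ d d′ → src d ≡ src d′ → Orbit rot d d′

    -- The face whose boundary walk traverses d; `nothing` is the unbounded one.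
    face         : Dart → Maybe Cell
    face-φ       : ∀ d → face (φ d) ≡ face d
    face-orbit   : ∀ d d′ → face d ≡ face d′ → Orbit φ d d′
    cell-dart    : ∀ c → ∃[ d ] face d ≡ just c
    -- Conditional, because the one-vertex board has no darts at all.
    outer-dart   : Dart → ∃[ d ] face d ≡ nothing

    -- Euler's formula, the unbounded face being counted by the 1.
    planar       : nV + (nC + 1) ≡ nE + 2

  _∈ᵉ_ : Vertex → Edge → Set
  v ∈ᵉ e = ∃[ b ] src (e , b) ≡ v

  _∈ᶜ_ : Edge → Cell → Set
  e ∈ᶜ c = ∃[ b ] face (e , b) ≡ just c

-- Symmetries need not preserve the rotation: reflections are allowed.
record Symmetry (G : Board) : Set where
  open Board G
  field
    onVertex : Permutation′ nV
    onEdge   : Permutation′ nE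
    onCell   : Permutation′ nC

    -- Incidence of vertices and edges; since G is simple, onDart is determined
    -- by onVertex.
    onDart      : Dart → Dart
    onDart-edge : ∀ d → edge (onDart d) ≡ onEdge ⟨$⟩ʳ edge d
    onDart-src  : ∀ d → src (onDart d) ≡ onVertex ⟨$⟩ʳ src d
    onDart-tgt  : ∀ d → tgt (onDart d) ≡ onVertex ⟨$⟩ʳ tgt d

    -- Incidence of edges and cells: the boundary of a cell c, directed around
    -- c, is sent to the boundary of the image cell, directed around that cell
    -- either in the same sense or in the opposite sense.
    onDart-face : ∀ c →
      (∀ d → face d ≡ just c ⇔ face (onDart d) ≡ just (onCell ⟨$⟩ʳ c))
      ⊎ (∀ d → face d ≡ just c ⇔ face (rev (onDart d)) ≡ just (onCell ⟨$⟩ʳ c))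

record Involution (G : Board) : Set where
  open Board G
  field
    symmetry : Symmetry G
  open Symmetry symmetry public

  τᵛ : Vertex → Vertex
  τᵛ v = onVertex ⟨$⟩ʳ v

  τᵉ : Edge → Edge
  τᵉ e = onEdge ⟨$⟩ʳ e

  τᶜ : Cell → Cell
  τᶜ c = onCell ⟨$⟩ʳ c

  field
    involutiveᵛ : ∀ v → τᵛ (τᵛ v) ≡ v
    involutiveᵉ : ∀ e → τᵉ (τᵉ e) ≡ e
    involutiveᶜ : ∀ c → τᶜ (τᶜ c) ≡ c
    nontrivial  : ¬ ((∀ v → τᵛ v ≡ v) × (∀ e → τᵉ e ≡ e) × (∀ c → τᶜ c ≡ c))

  SelfInvolutiveEdge : Edge → Set
  SelfInvolutiveEdge e = τᵉ e ≡ e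

  SelfInvolutiveCell : Cell → Set
  SelfInvolutiveCell c = τᶜ c ≡ c

  NowhereInvolutiveCell : Cell → Set
  NowhereInvolutiveCell c = ∀ e → e ∈ᶜ c → ¬ (τᵉ e ∈ᶜ c)

data Player : Set where
  player1 player2 : Player

opponent : Player → Player
opponent player1 = player2
opponent player2 = player1

module Game (G : Board) where
  open Board G

  Marking : Set
  Marking = Vec (Maybe Bool) nE

  unmarked : Marking
  unmarked = replicate nE nothing

  Unmarked : Marking → Edge → Set
  Unmarked M e = lookup M e ≡ nothing

  Arrow : Marking → Dart → Set
  Arrow M (e , b) = lookup M e ≡ just b

  mark : Marking → Dart → Marking
  mark M (e , b) = M [ e ]≔ just b

  Sink : Marking → Vertex → Set
  Sink M v = ∀ d → tgt d ≡ v → Arrow M d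

  Source : Marking → Vertex → Set
  Source M v = ∀ d → src d ≡ v → Arrow M d

  -- Whenever there is an edge, the empty board has no sink or source, so a move
  -- creates one exactly when one is present afterwards.
  Legal : Marking → Dart → Set
  Legal M d = Unmarked M (edge d)
    × (∀ v → ¬ Sink (mark M d) v)
    × (∀ v → ¬ Source (mark M d) v)

  -- An edge with c on both sides occurs in the boundary walk in both
  -- directions, so a cell with such an edge is never a cycle cell.
  CycleCell : Marking → Cell → Set
  CycleCell M c = (∀ d → face d ≡ just c → Arrow M d)
                ⊎ (∀ d → face d ≡ just c → Arrow M (rev d))

  HasCycleCell : Marking → Set
  HasCycleCell M = ∃ (CycleCell M)

  -- Strategy p q M: a strategy tree guaranteeing p a win from the marking M
  -- with q to move.  The constructor `reply` covers the end of play: an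
  -- opponent without a legal move loses, p having made the last move.  This
  -- includes, by the usual convention, a board on which Player 1 has no legal
  -- first move: Player 2 wins there.
  data Strategy (p : Player) : Player → Marking → Set where
    won   : ∀ {M} → HasCycleCell M → Strategy p (opponent p) M
    move  : ∀ {M} → ¬ HasCycleCell M →
            (d : Dart) → Legal M d → Strategy p (opponent p) (mark M d) →
            Strategy p p M
    reply : ∀ {M} → ¬ HasCycleCell M →
            (∀ d → Legal M d → Strategy p p (mark M d)) →
            Strategy p (opponent p) M

  HasWinningStrategy : Player → Set
  HasWinningStrategy p = Strategy p player1 unmarked

{-# OPTIONS --safe #-}
-- The winner p answers every arrow d by σ d, the reversed τ-image of d, unless
-- some cell can be completed to a cycle cell at once.  After each of p's moves
-- the marking is σ-symmetric, so the partner of a sink is a source, and an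
-- answer creating a sink or source would force the opponent's arrow to have
-- created one already, or its edge to be self-involutive.  The opponent never
-- completes a cycle cell: in a self-involutive cell the partner of the edge just
-- marked is still unmarked, and if a nowhere-involutive cell lacked only one
-- arrow, then it or its partner would already have lacked only one arrow when p
-- was to move.
module Submission where

open import Defs
open import Data.Bool.Base using (Bool; true; false; not)
open import Data.Bool.Properties using (not-involutive; ¬-not; not-¬)
import Data.Bool.Properties as Bool
open import Data.Empty using (⊥-elim)
open import Data.Fin.Base using (Fin; zero; suc)
import Data.Fin.Properties as Fin
open import Data.Maybe.Base using (Maybe; just; nothing)
open import Data.Maybe.Properties using (just-injective)
import Data.Maybe.Properties as Maybe
open import Data.Nat.Base using (ℕ; zero; suc; _<_; s≤s)
open import Data.Nat.Properties using (≤-reflexive; <-trans; <-≤-trans; n<1+n)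
open import Data.Product.Base using (∃; _×_; _,_; proj₁; proj₂)
open import Data.Sum.Base using (_⊎_; inj₁; inj₂; [_,_]′)
import Data.Sum.Base as Sum
open import Data.Vec.Base using (Vec; _∷_; lookup; _[_]≔_)
open import Data.Vec.Properties
  using (lookup∘update; lookup∘update′; lookup-replicate)
open import Function.Base using (_∘_)
open import Function.Bundles using (Equivalence; Inverse)
open import Relation.Binary.Construct.Closure.ReflexiveTransitive using (Star; ε; _◅_)
open import Relation.Binary.PropositionalEquality
  using (_≡_; _≢_; refl; sym; trans; cong; subst; module ≡-Reasoning)
open import Relation.Nullary.Decidable using (Dec; yes; no; map′; _×-dec_; _⊎-dec_; _→-dec_)
open import Relation.Nullary.Negation.Core using (¬_)

-- Darts and the count of unmarked edges.

rev-involutive : ∀ {n} (d : DartOf n) → rev (rev d) ≡ d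
rev-involutive (e , b) = cong (e ,_) (not-involutive b)

rev-of-same-edge : ∀ {n} (x d : DartOf n) → edge x ≡ edge d → x ≡ d ⊎ x ≡ rev d
rev-of-same-edge (e , b) (_ , b′) refl with b Bool.≟ b′
... | yes refl = inj₁ refl
... | no b≢b′  = inj₂ (cong (e ,_) (¬-not b≢b′))

all-constant⇒≡1 : ∀ {n} (i : Fin n) → (∀ j → j ≡ i) → n ≡ 1
all-constant⇒≡1 {suc zero}    _ _ = refl
all-constant⇒≡1 {suc (suc n)} i h with () ← trans (h zero) (sym (h (suc zero)))

-- The measure for the recursion in `play`: every move lowers it by one.
free : ∀ {n} → Vec (Maybe Bool) n → ℕ
free Vec.[]        = 0
free (nothing ∷ M) = suc (free M)
free (just _ ∷ M)  = free M

free-update : ∀ {n} (M : Vec (Maybe Bool) n) e b → lookup M e ≡ nothing →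
              free M ≡ suc (free (M [ e ]≔ just b))
free-update (nothing ∷ M) zero    b _ = refl
free-update (nothing ∷ M) (suc e) b h = cong suc (free-update M e b h)
free-update (just _ ∷ M)  (suc e) b h = free-update M e b h

module Marked (G : Board) where
  open Board G
  open Game G

  -- Deciding whether some cell can be completed at once.

  anyDart? : {P : Dart → Set} → (∀ d → Dec (P d)) → Dec (∃ P)
  anyDart? P? = map′ (λ { (e , inj₁ p) → (e , true) , p ; (e , inj₂ p) → (e , false) , p })
                     (λ { ((e , true) , p) → e , inj₁ p ; ((e , false) , p) → e , inj₂ p })
                     (Fin.any? λ e → P? (e , true) ⊎-dec P? (e , false))

  allDarts? : {P : Dart → Set} → (∀ d → Dec (P d)) → Dec (∀ d → P d)
  allDarts? P? = map′ (λ { h (e , true) → proj₁ (h e) ; h (e , false) → proj₂ (h e) })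
                      (λ h e → h (e , true) , h (e , false))
                      (Fin.all? λ e → P? (e , true) ×-dec P? (e , false))

  on? : ∀ d c → Dec (face d ≡ just c)
  on? d c = Maybe.≡-dec Fin._≟_ (face d) (just c)

  _∈ᶜ?_ : ∀ e c → Dec (e ∈ᶜ c)
  e ∈ᶜ? c = map′ [ true ,_ , false ,_ ]′
                 (λ { (true , p) → inj₁ p ; (false , p) → inj₂ p })
                 (on? (e , true) c ⊎-dec on? (e , false) c)

  unmarked? : ∀ M e → Dec (Unmarked M e)
  unmarked? M e = Maybe.≡-dec Bool._≟_ (lookup M e) nothing

  arrow? : ∀ M d → Dec (Arrow M d)
  arrow? M (e , b) = Maybe.≡-dec Bool._≟_ (lookup M e) (just b)

  hasCycleCell? : ∀ M → Dec (HasCycleCell M)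
  hasCycleCell? M = Fin.any? λ c →
    allDarts? (λ d → on? d c →-dec arrow? M d) ⊎-dec
    allDarts? (λ d → on? d c →-dec arrow? M (rev d))

  -- Legality is left out, so that such a move can be carried from one marking to another without
  -- looking at vertices; `completing-legal` restores it.
  Completing : Marking → Dart → Set
  Completing M d = Unmarked M (edge d) × HasCycleCell (mark M d)

  completing? : ∀ M → Dec (∃ (Completing M))
  completing? M = anyDart? λ d → unmarked? M (edge d) ×-dec hasCycleCell? (mark M d)

  -- Arrows, sinks and sources under one further move.

  ∈ᶜ-edge : ∀ {x c} → face x ≡ just c → edge x ∈ᶜ c
  ∈ᶜ-edge {e , b} h = b , h

  arrow-rev : ∀ {M} d → Arrow M d → ¬ Arrow M (rev d)
  arrow-rev (e , b) h h′ = not-¬ refl (just-injective (trans (sym h) h′))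

  arrow-unmarked : ∀ {M} d → Arrow M d → ¬ Unmarked M (edge d)
  arrow-unmarked d h h′ with () ← trans (sym h) h′

  unmarked-empty : ∀ d → ¬ Arrow unmarked d
  unmarked-empty d h = arrow-unmarked {unmarked} d h (lookup-replicate (edge d) nothing)

  arrow-new : ∀ M d → Arrow (mark M d) d
  arrow-new M (e , b) = lookup∘update e M (just b)

  arrow-split : ∀ M d x → Arrow (mark M d) x → x ≡ d ⊎ Arrow M x
  arrow-split M d x h with edge x Fin.≟ edge d
  ... | no x≢d = inj₂ (trans (sym (lookup∘update′ x≢d M _)) h)
  ... | yes x≡d with rev-of-same-edge x d x≡d
  ...   | inj₁ eq   = inj₁ eq
  ...   | inj₂ refl = ⊥-elim (arrow-rev {mark M d} d (arrow-new M d) h)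

  arrow-keep : ∀ M d x → Unmarked M (edge d) → Arrow M x → Arrow (mark M d) x
  arrow-keep M d x d-free h with edge x Fin.≟ edge d
  ... | no x≢d   = trans (lookup∘update′ x≢d M _) h
  ... | yes refl = ⊥-elim (arrow-unmarked {M} x h d-free)

  unmarked-mark : ∀ M d {e} → e ≢ edge d → Unmarked M e → Unmarked (mark M d) e
  unmarked-mark M d e≢d h = trans (lookup∘update′ e≢d M _) h

  unmarked-before : ∀ M d e → Unmarked (mark M d) e → Unmarked M e
  unmarked-before M d e h with e Fin.≟ edge d
  ... | no e≢d   = trans (sym (lookup∘update′ e≢d M _)) h
  ... | yes refl = ⊥-elim (arrow-unmarked {mark M d} d (arrow-new M d) h)

  -- At a vertex other than the head of `d`, every arrow pointing in differs from `d`, so a sink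
  -- there would have existed before.
  sink-new : ∀ M d → (∀ v → ¬ Sink M v) → ∀ {v} → Sink (mark M d) v → v ≡ tgt d
  sink-new M d none {v} s with v Fin.≟ tgt d
  ... | yes eq = eq
  ... | no v≢  = ⊥-elim (none v λ x eq →
    [ (λ { refl → ⊥-elim (v≢ (sym eq)) }) , (λ h → h) ]′ (arrow-split M d x (s x eq)))

  source-new : ∀ M d → (∀ v → ¬ Source M v) → ∀ {v} → Source (mark M d) v → v ≡ src d
  source-new M d none {v} s with v Fin.≟ src d
  ... | yes eq = eq
  ... | no v≢  = ⊥-elim (none v λ x eq →
    [ (λ { refl → ⊥-elim (v≢ (sym eq)) }) , (λ h → h) ]′ (arrow-split M d x (s x eq)))

  -- Boundary walks and cycle cells.

  tgt-rev : ∀ d → tgt (rev d) ≡ src d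
  tgt-rev d = cong src (rev-involutive d)

  src-φ : ∀ d → src (φ d) ≡ tgt d
  src-φ d = rot-src (rev d)

  φ⁻¹ : Dart → Dart
  φ⁻¹ d = rev (Inverse.from rotation d)

  φ-φ⁻¹ : ∀ d → φ (φ⁻¹ d) ≡ d
  φ-φ⁻¹ d = trans (cong rot (rev-involutive _)) (Inverse.strictlyInverseˡ rotation d)

  φ-irrefl : ∀ d → φ d ≢ d
  φ-irrefl d h = no-loops d (trans (cong src (sym h)) (src-φ d))

  -- Only arrows on the edges of `c` count, so the two markings need comparing only there.
  cycleCell-local : ∀ {M N c} → (∀ x → edge x ∈ᶜ c → Arrow M x → Arrow N x) →
                    CycleCell M c → CycleCell N c
  cycleCell-local h = Sum.map (λ g x p → h x (∈ᶜ-edge p) (g x p))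
                              (λ g x p → h (rev x) (∈ᶜ-edge p) (g x p))

  cycleCell-unmark : ∀ M d {c} → ¬ (edge d ∈ᶜ c) → CycleCell (mark M d) c → CycleCell M c
  cycleCell-unmark M d d∉c = cycleCell-local {mark M d} {M} λ x x∈c h →
    [ (λ { refl → ⊥-elim (d∉c x∈c) }) , (λ h′ → h′) ]′ (arrow-split M d x h)

  -- Lying off `c`, the arrow `d` contributes nothing to the cycle, so `x` completes `c` without it.
  completing-before : ∀ M d x {c} → ¬ (edge d ∈ᶜ c) → Unmarked (mark M d) (edge x) →
                      CycleCell (mark (mark M d) x) c → Completing M x
  completing-before M d x {c} d∉c x-free cyc = x-free′ , c ,
    cycleCell-local {mark (mark M d) x} {mark M x} earlier cyc
    where
    x-free′ = unmarked-before M d (edge x) x-free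

    earlier : ∀ y → edge y ∈ᶜ c → Arrow (mark (mark M d) x) y → Arrow (mark M x) y
    earlier y y∈c h with arrow-split (mark M d) x y h
    ... | inj₁ refl = arrow-new M x
    ... | inj₂ h′ with arrow-split M d y h′
    ...   | inj₁ refl = ⊥-elim (d∉c y∈c)
    ...   | inj₂ h″   = arrow-keep M x y x-free′ h″

  cycleCell-marked : ∀ {M c} e → CycleCell M c → e ∈ᶜ c → ¬ Unmarked M e
  cycleCell-marked {M} e (inj₁ h) (b , p) = arrow-unmarked {M} (e , b) (h _ p)
  cycleCell-marked {M} e (inj₂ h) (b , p) = arrow-unmarked {M} (e , not b) (h _ p)

  -- The boundary walk enters src x by φ⁻¹ x and leaves it by x.
  cycleCell-src : ∀ {M c} → CycleCell M c → ∀ x → face x ≡ just c →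
                  ¬ Sink M (src x) × ¬ Source M (src x)
  cycleCell-src {M} {c} cyc x p = no-sink cyc , no-source cyc
    where
    y = φ⁻¹ x

    y-on : face y ≡ just c
    y-on = trans (sym (face-φ y)) (trans (cong face (φ-φ⁻¹ x)) p)

    tgt-y : tgt y ≡ src x
    tgt-y = trans (sym (src-φ y)) (cong src (φ-φ⁻¹ x))

    no-sink : CycleCell M c → ¬ Sink M (src x)
    no-sink (inj₁ h) s = arrow-rev {M} x (h x p) (s (rev x) (tgt-rev x))
    no-sink (inj₂ h) s = arrow-rev {M} y (s y tgt-y) (h y y-on)

    no-source : CycleCell M c → ¬ Source M (src x)
    no-source (inj₁ h) s = arrow-rev {M} y (h y y-on) (s (rev y) tgt-y)
    no-source (inj₂ h) s = arrow-rev {M} x (s x refl) (h x p)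

  -- The boundary walk of `c` runs along the edge in some direction and so passes through both of
  -- its ends.
  cycleCell-endpoint : ∀ {M c} → CycleCell M c → ∀ d → edge d ∈ᶜ c →
                       ¬ Sink M (src d) × ¬ Source M (src d)
  cycleCell-endpoint {M} {c} cyc d (b , p) with rev-of-same-edge (edge d , b) d refl
  ... | inj₁ refl = cycleCell-src {M} cyc d p
  -- The walk traverses `rev d` here, so the dart of the walk that leaves `src d` is the next one,
  -- `φ (rev d)`.
  ... | inj₂ refl = subst (λ v → ¬ Sink M v × ¬ Source M v)
                          (trans (src-φ (rev d)) (tgt-rev d))
                          (cycleCell-src {M} cyc (φ (rev d)) (trans (face-φ (rev d)) p))

  -- A new sink can only be the head of `d` and a new source only its tail, but both ends lie on the
  -- completed cycle, which has an arrow in and an arrow out at each.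
  completing-legal : ∀ M d → ¬ HasCycleCell M → (∀ v → ¬ Sink M v) → (∀ v → ¬ Source M v) →
                     Completing M d → Legal M d
  completing-legal M d no-cycle no-sink no-source (d-free , c , cyc) with edge d ∈ᶜ? c
  ... | no d∉c  = ⊥-elim (no-cycle (c , cycleCell-unmark M d d∉c cyc))
  ... | yes d∈c = d-free
    , (λ v s → proj₁ (cycleCell-endpoint {mark M d} cyc (rev d) d∈c)
                     (subst (Sink (mark M d)) (sink-new M d no-sink s) s))
    , (λ v s → proj₂ (cycleCell-endpoint {mark M d} cyc d d∈c)
                     (subst (Source (mark M d)) (source-new M d no-source s) s))

  -- Without loops a boundary walk has at least two darts.
  one-arrow-no-cycle : ∀ {M} d → (∀ x → Arrow M x → x ≡ d) → ∀ c → ¬ CycleCell M c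
  one-arrow-no-cycle {M} d only c cyc with cell-dart c
  one-arrow-no-cycle {M} d only c (inj₁ h) | x , p =
    φ-irrefl x (trans (only _ (h _ (trans (face-φ x) p))) (sym (only _ (h x p))))
  one-arrow-no-cycle {M} d only c (inj₂ h) | x , p =
    φ-irrefl x (begin
      φ x              ≡⟨ rev-involutive (φ x) ⟨
      rev (rev (φ x))  ≡⟨ cong rev (only _ (h _ (trans (face-φ x) p))) ⟩
      rev d            ≡⟨ cong rev (only _ (h x p)) ⟨
      rev (rev x)      ≡⟨ rev-involutive x ⟩
      x                ∎)
    where open ≡-Reasoning

  -- The empty board and the board with one arrow.

  only-arrow : ∀ d x → Arrow (mark unmarked d) x → x ≡ d
  only-arrow d x h = [ (λ eq → eq) , (λ h′ → ⊥-elim (unmarked-empty x h′)) ]′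
                     (arrow-split unmarked d x h)

  unmarked-not-completing : ¬ ∃ (Completing unmarked)
  unmarked-not-completing (d , _ , c , cyc) =
    one-arrow-no-cycle {mark unmarked d} d (only-arrow d) c cyc

  unmarked-no-cycle : ¬ HasCycleCell unmarked
  unmarked-no-cycle (c , cyc) with cell-dart c
  ... | x , p = [ (λ h → unmarked-empty x (h x p)) , (λ h → unmarked-empty (rev x) (h x p)) ]′ cyc

  -- Take a path from `v` to an end of `e`: its first dart leaves `v`, and if it is empty, `v` is
  -- that end.
  incident : Edge → ∀ v → ∃ λ d → src d ≡ v
  incident e v with connected v (src (e , true))
  ... | ε                   = (e , true) , refl
  ... | (d , src≡v , _) ◅ _ = d , src≡v

-- The involution on darts and on cycle cells.

module Mirror (G : Board) (τ : Involution G) where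
  open Board G
  open Involution τ
  open Game G
  open Marked G

  -- In a simple graph a dart is determined by its two ends, so comparing those is enough.
  onDart-involutive : ∀ d → onDart (onDart d) ≡ d
  onDart-involutive d = no-multi _ _
    (trans (onDart-src _) (trans (cong τᵛ (onDart-src d)) (involutiveᵛ _)))
    (trans (onDart-tgt _) (trans (cong τᵛ (onDart-tgt d)) (involutiveᵛ _)))

  onDart-rev : ∀ d → onDart (rev d) ≡ rev (onDart d)
  onDart-rev d = no-multi _ _
    (trans (onDart-src _) (sym (onDart-tgt d)))
    (trans (onDart-tgt _) (trans (cong τᵛ (tgt-rev d))
                                 (sym (trans (tgt-rev (onDart d)) (onDart-src d)))))

  -- The reversal also makes `σ` fix both darts of an edge whose ends are exchanged by `τᵛ`.
  σ : Dart → Dart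
  σ d = rev (onDart d)

  edge-σ : ∀ d → edge (σ d) ≡ τᵉ (edge d)
  edge-σ = onDart-edge

  src-σ : ∀ d → src (σ d) ≡ τᵛ (tgt d)
  src-σ = onDart-tgt

  tgt-σ : ∀ d → tgt (σ d) ≡ τᵛ (src d)
  tgt-σ d = trans (tgt-rev (onDart d)) (onDart-src d)

  σ-involutive : ∀ d → σ (σ d) ≡ d
  σ-involutive d = begin
    rev (onDart (rev (onDart d)))  ≡⟨ cong rev (onDart-rev (onDart d)) ⟩
    rev (rev (onDart (onDart d)))  ≡⟨ rev-involutive _ ⟩
    onDart (onDart d)              ≡⟨ onDart-involutive d ⟩
    d                              ∎
    where open ≡-Reasoning

  τᵛ-swap : ∀ {u v} → u ≡ τᵛ v → τᵛ u ≡ v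
  τᵛ-swap h = trans (cong τᵛ h) (involutiveᵛ _)

  -- Here `τᵛ` exchanges the ends of `d`, so `σ d` has the same tail and the same head as `d`.
  σ-fixed : ∀ d → src d ≡ τᵛ (tgt d) → σ d ≡ d
  σ-fixed d h = no-multi _ _ (trans (src-σ d) (sym h)) (trans (tgt-σ d) (τᵛ-swap h))

  ∈ᶜ-τ : ∀ e c → e ∈ᶜ c → τᵉ e ∈ᶜ τᶜ c
  ∈ᶜ-τ e c (b , p) = subst (_∈ᶜ τᶜ c) (onDart-edge (e , b))
    ([ (λ h → ∈ᶜ-edge (Equivalence.to (h _) p)) , (λ h → ∈ᶜ-edge (Equivalence.to (h _) p)) ]′
     (onDart-face c))

  -- Since `σ` reverses darts, the two orientations of a cycle are swapped when `onDart` keeps the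
  -- sense around `c`, and kept when it inverts that sense.
  cycleCell-τ : ∀ {M N} → (∀ x → Arrow M x → Arrow N (σ x)) →
                ∀ c → CycleCell M c → CycleCell N (τᶜ c)
  cycleCell-τ {M} {N} f c cyc with onDart-face c
  cycleCell-τ {M} {N} f c cyc | inj₁ on⇔ =
    [ (λ h → inj₂ λ y p → image y (h _ (pre y p)))
    , (λ h → inj₁ λ y p → image′ y (h _ (pre y p))) ]′ cyc
    where
    pre : ∀ y → face y ≡ just (τᶜ c) → face (onDart y) ≡ just c
    pre y p = Equivalence.from (on⇔ _) (trans (cong face (onDart-involutive y)) p)

    image : ∀ y → Arrow M (onDart y) → Arrow N (rev y)
    image y a = subst (Arrow N) (cong rev (onDart-involutive y)) (f _ a)

    image′ : ∀ y → Arrow M (rev (onDart y)) → Arrow N y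
    image′ y a = subst (Arrow N) (σ-involutive y) (f _ a)
  cycleCell-τ {M} {N} f c cyc | inj₂ on⇔ =
    [ (λ h → inj₁ λ y p → image y (h _ (pre y p)))
    , (λ h → inj₂ λ y p → image′ y (h _ (pre y p))) ]′ cyc
    where
    pre : ∀ y → face y ≡ just (τᶜ c) → face (σ y) ≡ just c
    pre y p = Equivalence.from (on⇔ _) (trans (cong face (σ-involutive y)) p)

    image : ∀ y → Arrow M (σ y) → Arrow N y
    image y a = subst (Arrow N) (σ-involutive y) (f _ a)

    image′ : ∀ y → Arrow M (rev (σ y)) → Arrow N (rev y)
    image′ y a = subst (Arrow N)
      (cong rev (trans (cong onDart (rev-involutive (onDart y))) (onDart-involutive y)))
      (f _ a)

  -- Symmetric markings and mirrored answers.

  Symmetric : Marking → Set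
  Symmetric M = ∀ x → Arrow M x → Arrow M (σ x)

  unmarked-symmetric : Symmetric unmarked
  unmarked-symmetric x h = ⊥-elim (unmarked-empty x h)

  sink-τ : ∀ {M v} → Symmetric M → Sink M v → Source M (τᵛ v)
  sink-τ {M} sy s x eq = subst (Arrow M) (σ-involutive x)
    (sy _ (s (σ x) (trans (tgt-σ x) (τᵛ-swap eq))))

  source-τ : ∀ {M v} → Symmetric M → Source M v → Sink M (τᵛ v)
  source-τ {M} sy s x eq = subst (Arrow M) (σ-involutive x)
    (sy _ (s (σ x) (trans (src-σ x) (τᵛ-swap eq))))

  -- An arrow on the partner edge would have its mirror image on `e`.
  unmarked-τ : ∀ M → Symmetric M → ∀ e → Unmarked M e → Unmarked M (τᵉ e)
  unmarked-τ M sy e h with lookup M (τᵉ e) in eq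
  ... | nothing = refl
  ... | just b  = ⊥-elim (arrow-unmarked {M} (σ (τᵉ e , b)) (sy _ eq)
                    (subst (Unmarked M) (sym (trans (edge-σ _) (involutiveᵉ e))) h))

  -- Two markings are allowed so that `N` may already contain the opponent's arrow, as in
  -- `mirror-symmetric`.
  mark-σ : ∀ {M N} d → Unmarked N (edge (σ d)) → (∀ x → Arrow M x → Arrow N (σ x)) →
           ∀ x → Arrow (mark M d) x → Arrow (mark N (σ d)) (σ x)
  mark-σ {M} {N} d d-free f x h with arrow-split M d x h
  ... | inj₁ refl = arrow-new N (σ d)
  ... | inj₂ h′   = arrow-keep N (σ d) (σ x) d-free (f x h′)

  mirror-symmetric : ∀ M d → Symmetric M → Unmarked M (edge d) →
                     Unmarked (mark M d) (edge (σ d)) →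
                     Symmetric (mark (mark M d) (σ d))
  mirror-symmetric M d sy d-free σd-free x h with arrow-split (mark M d) (σ d) x h
  ... | inj₁ refl = subst (Arrow (mark (mark M d) (σ d))) (sym (σ-involutive d))
                      (arrow-keep (mark M d) (σ d) d σd-free (arrow-new M d))
  ... | inj₂ h′   = mark-σ {M} {mark M d} d σd-free
                      (λ y a → arrow-keep M d (σ y) d-free (sy y a)) x h′

  -- A sink created by `σ d` is its head `τᵛ (src d)`. By symmetry `src d` is then a source, also a
  -- new one, hence the tail `τᵛ (tgt d)` of `σ d`. So `τᵛ` exchanges the ends of `d`, which forces
  -- `σ d ≡ d`. Sources are dual.
  mirror-legal : ∀ M d → Legal M d → Unmarked (mark M d) (edge (σ d)) → σ d ≢ d →
                 Symmetric (mark (mark M d) (σ d)) → Legal (mark M d) (σ d)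
  mirror-legal M d (_ , no-sink , no-source) σd-free σd≢d sy = σd-free
    , (λ v s → let v≡τsrc = trans (sink-new M′ (σ d) no-sink s) (tgt-σ d) in
        σd≢d (σ-fixed d (trans (sym (τᵛ-swap v≡τsrc))
          (trans (source-new M′ (σ d) no-source (sink-τ {mark M′ (σ d)} sy s)) (src-σ d)))))
    , (λ v s → let v≡τtgt = trans (source-new M′ (σ d) no-source s) (src-σ d) in
        σd≢d (σ-fixed d (sym (τᵛ-swap (trans (sym (τᵛ-swap v≡τtgt))
          (trans (sink-new M′ (σ d) no-sink (source-τ {mark M′ (σ d)} sy s)) (tgt-σ d)))))))
    where M′ = mark M d

  -- The invariant of the winner's positions.

  NoThreat : Marking → Set
  NoThreat M = ∀ c → NowhereInvolutiveCell c → ∀ d → Unmarked M (edge d) →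
               ¬ CycleCell (mark M d) c

  -- Either c or its partner avoids the edge of d.
  no-threat-after : ∀ M d → Symmetric (mark M d) → ¬ ∃ (Completing M) → NoThreat (mark M d)
  no-threat-after M d sy none c nw x x-free cyc with edge d ∈ᶜ? c
  ... | no d∉c  = none (x , completing-before M d x d∉c x-free cyc)
  ... | yes d∈c = none (σ x , completing-before M d (σ x) d∉τc σx-free
                    (cycleCell-τ {mark N x} {mark N (σ x)} (mark-σ {N} {N} x σx-free sy) c cyc))
    where
    N = mark M d

    σx-free : Unmarked N (edge (σ x))
    σx-free = subst (Unmarked N) (sym (edge-σ x)) (unmarked-τ N sy (edge x) x-free)

    d∉τc : ¬ (edge d ∈ᶜ τᶜ c)
    d∉τc h = nw (edge d) d∈c
      (subst (τᵉ (edge d) ∈ᶜ_) (involutiveᶜ c) (∈ᶜ-τ (edge d) (τᶜ c) h))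

  -- Meant for positions with the opponent to move; `self-edge-marked` leaves the opponent only
  -- edges that differ from their partners.
  record Invariant (M : Marking) : Set where
    field
      symmetric        : Symmetric M
      no-threat        : NoThreat M
      self-edge-marked : ∀ e → SelfInvolutiveEdge e → ¬ Unmarked M e

  open Invariant

  partner-free : ∀ M → Invariant M → ∀ d → Unmarked M (edge d) →
                 τᵉ (edge d) ≢ edge d × Unmarked (mark M d) (τᵉ (edge d))
  partner-free M inv d d-free = τe≢e ,
    unmarked-mark M d τe≢e (unmarked-τ M (symmetric inv) (edge d) d-free)
    where
    τe≢e : τᵉ (edge d) ≢ edge d
    τe≢e h = self-edge-marked inv (edge d) h d-free

  -- The strategy from a position satisfying the invariant.

  module Play (dichotomy : ∀ c → SelfInvolutiveCell c ⊎ NowhereInvolutiveCell c)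
              (p : Player) where

    opponent-completes-nothing : ∀ M → Invariant M → ¬ HasCycleCell M →
      ∀ d → Unmarked M (edge d) → ¬ HasCycleCell (mark M d)
    opponent-completes-nothing M inv none d d-free (c , cyc) with dichotomy c
    ... | inj₂ nowhere = no-threat inv c nowhere d d-free cyc
    ... | inj₁ self with edge d ∈ᶜ? c
    ...   | no d∉c  = none (c , cycleCell-unmark M d d∉c cyc)
    ...   | yes d∈c = cycleCell-marked {mark M d} (τᵉ (edge d)) cyc
                        (subst (τᵉ (edge d) ∈ᶜ_) self (∈ᶜ-τ (edge d) c d∈c))
                        (proj₂ (partner-free M inv d d-free))

    -- The recursion is on `n`, a strict bound on the number of unmarked edges, because the marking
    -- itself does not shrink structurally.
    play : ∀ n M → free M < n → Invariant M → Strategy p (opponent p) M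
    play (suc n) M (s≤s bound) inv with hasCycleCell? M
    ... | yes cycle = won cycle
    ... | no none   = reply none answer
      where
      answer : ∀ d → Legal M d → Strategy p p (mark M d)
      answer d legal@(d-free , no-sink , no-source)
        with opponent-completes-nothing M inv none d d-free | completing? (mark M d)
      ... | none′ | yes (x , completing) =
        -- The opponent's legal move left no sink or source, which makes the completing move legal.
        move none′ x (completing-legal (mark M d) x none′ no-sink no-source completing)
             (won (proj₂ completing))
      ... | none′ | no no-completing =
        move none′ (σ d) (mirror-legal M d legal σd-free σd≢d sy)
             (play n N (<-≤-trans fewer bound) inv′)
        where
        N = mark (mark M d) (σ d)

        σd-free : Unmarked (mark M d) (edge (σ d))
        σd-free = subst (Unmarked (mark M d)) (sym (edge-σ d))
                        (proj₂ (partner-free M inv d d-free))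

        σd≢d : σ d ≢ d
        σd≢d h = proj₁ (partner-free M inv d d-free) (trans (sym (edge-σ d)) (cong edge h))

        sy : Symmetric N
        sy = mirror-symmetric M d (symmetric inv) d-free σd-free

        fewer : free N < free M
        fewer = <-trans
          (≤-reflexive (sym (free-update (mark M d) _ _ σd-free)))
          (≤-reflexive (sym (free-update M _ _ d-free)))

        inv′ : Invariant N
        inv′ = record
          { symmetric        = sy
          ; no-threat        = no-threat-after (mark M d) (σ d) sy no-completing
          ; self-edge-marked = λ e self → self-edge-marked inv e self
              ∘ unmarked-before M d e ∘ unmarked-before (mark M d) (σ d) e
          }

    win : ∀ M → Invariant M → Strategy p (opponent p) M
    win M = play (suc (free M)) M (n<1+n (free M))

  unmarked-invariant : (∀ e → ¬ SelfInvolutiveEdge e) → Invariant unmarked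
  unmarked-invariant no-self = record
    { symmetric        = unmarked-symmetric
    ; no-threat        = λ c _ d d-free cyc → unmarked-not-completing (d , d-free , c , cyc)
    ; self-edge-marked = λ e self _ → no-self e self
    }

  -- Opening on the only self-involutive edge.

  module Opening (d : Dart) (self : SelfInvolutiveEdge (edge d))
                 (only-self : ∀ e → SelfInvolutiveEdge e → e ≡ edge d)
                 (moved : τᵛ (src d) ≢ src d) where

    M₁ : Marking
    M₁ = mark unmarked d

    only-d : ∀ x → Arrow M₁ x → x ≡ d
    only-d = only-arrow d

    -- As `τᵛ` moves `src d`, the edge is flipped end for end, and the reversal in `σ` undoes the
    -- flip. Hence this single arrow is already a symmetric marking.
    σd≡d : σ d ≡ d
    σd≡d with rev-of-same-edge (onDart d) d (trans (onDart-edge d) self)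
    ... | inj₁ eq = ⊥-elim (moved (trans (sym (onDart-src d)) (cong src eq)))
    ... | inj₂ eq = trans (cong rev eq) (rev-involutive d)

    symmetric-M₁ : Symmetric M₁
    symmetric-M₁ x h = subst (λ y → Arrow M₁ (σ y)) (sym (only-d x h))
                         (subst (Arrow M₁) (sym σd≡d) (arrow-new unmarked d))

    invariant : Invariant M₁
    invariant = record
      { symmetric        = symmetric-M₁
      -- The opening is treated like an answer played when no cell could be completed.
      ; no-threat        = no-threat-after unmarked d symmetric-M₁ unmarked-not-completing
      ; self-edge-marked = λ e e-self e-free → arrow-unmarked {M₁} d (arrow-new unmarked d)
          (subst (Unmarked M₁) (only-self e e-self) e-free)
      }

    -- Both ends of d then have degree 1, so by connectedness they are all of G.
    sink⇒one-edge : ∀ v → Sink M₁ v → nE ≡ 1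
    sink⇒one-edge v sink = all-constant⇒≡1 (edge d) λ e → edge-is-d e (all-ends (src (e , true)))
      where
      into-v : ∀ x → tgt x ≡ v → x ≡ d
      into-v x eq = only-d x (sink x eq)

      out-of-τv : ∀ x → src x ≡ τᵛ v → x ≡ d
      out-of-τv x eq = only-d x (sink-τ {M₁} symmetric-M₁ sink x eq)

      out-of-v : ∀ x → src x ≡ v → rev x ≡ d
      out-of-v x eq = into-v (rev x) (trans (tgt-rev x) eq)

      v≡tgt : v ≡ tgt d
      v≡tgt with x , eq ← incident (edge d) v =
        trans (sym eq) (trans (sym (tgt-rev x)) (cong tgt (out-of-v x eq)))

      τv≡src : τᵛ v ≡ src d
      τv≡src = trans (cong τᵛ v≡tgt) (trans (sym (src-σ d)) (cong src σd≡d))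

      End : Vertex → Set
      End u = u ≡ v ⊎ u ≡ τᵛ v

      closed : ∀ {u w} → Star Adjacent u w → End u → End w
      closed ε end = end
      closed ((x , refl , refl) ◅ path) (inj₁ eq) =
        closed path (inj₂ (trans (cong src (out-of-v x eq)) (sym τv≡src)))
      closed ((x , refl , refl) ◅ path) (inj₂ eq) =
        closed path (inj₁ (trans (cong tgt (out-of-τv x eq)) (sym v≡tgt)))

      all-ends : ∀ u → End u
      all-ends u = closed (connected v u) (inj₁ refl)

      edge-is-d : ∀ e → End (src (e , true)) → e ≡ edge d
      edge-is-d e (inj₁ eq) = cong edge (out-of-v _ eq)
      edge-is-d e (inj₂ eq) = cong edge (out-of-τv _ eq)

    -- By symmetry a source at `v` gives a sink at `τᵛ v`, so excluding sinks suffices. On a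
    -- one-edge board the head of any arrow is a sink.
    opening-legal : nE ≢ 1 → Legal unmarked d
    opening-legal nE≢1 = lookup-replicate (edge d) nothing
      , (λ v sink → nE≢1 (sink⇒one-edge v sink))
      , (λ v source → nE≢1 (sink⇒one-edge (τᵛ v) (source-τ {M₁} symmetric-M₁ source)))

theorem5p1 : (G : Board) (τ : Involution G) →
    let open Board G
        open Involution τ
        open Game G
    in
    (∀ c → SelfInvolutiveCell c ⊎ NowhereInvolutiveCell c) →
    ((∀ e → ¬ SelfInvolutiveEdge e) → HasWinningStrategy player2)
    ×
    -- The one-edge board has no legal move at all and is excluded here.
    (nE ≢ 1 →
     ∀ e → SelfInvolutiveEdge e → (∀ e′ → SelfInvolutiveEdge e′ → e′ ≡ e) →
     (∀ v → v ∈ᵉ e → τᵛ v ≢ v) →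
     HasWinningStrategy player1)
theorem5p1 G τ dichotomy =
    (λ no-self → Play.win dichotomy player2 unmarked (unmarked-invariant no-self))
  , λ nE≢1 e self only-self moved →
      -- Either direction serves, as `σ` fixes both darts of this edge.
      let d = e , true
          open Opening d self only-self (moved _ (true , refl))
      in move unmarked-no-cycle d (opening-legal nE≢1)
           (Play.win dichotomy player1 M₁ invariant)
  where
  open Game G
  open Marked G
  open Mirror G τ
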